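{- Let $\mathcal{X}=(\Omega,S)$ be a homogeneous coherent configuration with maximum valency $k>1$ and indistinguishing number $c$, and let $X=S_k$. Suppose $|X|>6c(k-1)$. Then for every point $\alpha\in\Omega$, the pair $\mathcal{M}_\alpha=(\Delta_\alpha,M_\alpha)$ is a saturated matching configuration whose fibers are the sets $\alpha x$, $x\in X$ (with $\alpha x$ indexed by $x$). Moreover, $S_\alpha(x,y)\subseteq (M_\alpha(x,z)\cdot M_\alpha(z,y))^\cup$ for all $x,y,z\in X$ with $x\sim z\sim y$, where for a set $R$ of relations $R^\cup$ denotes the set of all unions of elements of $R$.
   Context: A coherent configuration on a finite set $\Omega$ is a pair $(\Omega,S)$, $S$ a partition of $\Omega\times\Omega$ such that the diagonal $1_\Omega$ is a union of elements of $S$, $S$ is closed under $s\mapsto s^*=\{(\beta,\alpha):(\alpha,\beta)\in s\}$, and for $r,s,t\in S$ the number $c_{rs}^t=|\beta r\cap\gamma s^*|$ (where $\beta r=\{\delta:(\beta,\delta)\in r\}$) does not depend on $(\beta,\gamma)\in t$. It is homogeneous if $1_\Omega\in S$; $n_s=|\beta s|$ is the valency, $S_k=\{s\in S:n_s=k\}$, and the indistinguishing number is $c=\max_{r\in S\setminus\{1_\Omega\}}\sum_{s\in S}c_{ss^*}^r$. For relations, $r\cdot s=\{(\beta,\delta):\exists\gamma,(\beta,\gamma)\in r,(\gamma,\delta)\in s\}$; for sets of relations $R\cdot R'=\{r\cdot r': r\in R, r'\in R'\}$; for $r,s\in S$, $rs$ denotes the set of basis relations contained in $r\cdot s$; $\alpha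 Y=\bigcup_{y\in Y}\alpha y$; $1_\Lambda=\{(\beta,\beta):\beta\in\Lambda\}$. For $x,y\in X$ define $x\sim y$ iff $|x^*y|=k$. Fix $\alpha\in\Omega$; for $r,x,y\in S$ let $r_{x,y}=r\cap(\alpha x\times\alpha y)$ and $S_\alpha(x,y)=\{r_{x,y}:r\in x^*y\}$. Set $\Delta_\alpha=\alpha X$ and $M_\alpha=\bigcup_{x,y\in X}M_\alpha(x,y)$, where $M_\alpha(x,y)=S_\alpha(x,y)$ if $x\sim y$; $M_\alpha(x,y)=\varnothing$ if $x\not\sim y$ and $x\ne y$; $M_\alpha(x,x)=\{1_{\alpha x}\}$ if $x\not\sim x$. A partial coherent configuration is a pair $(\Delta,M)$ where $M$ partitions a subset of $\Delta\times\Delta$, $1_\Delta$ is a union of elements of $M$, $M^*=M$, and for $r,s,t\in M$ the number $|\beta r\cap\gamma s^*|$ is independent of $(\beta,\gamma)\in t$; fibers are the sets $\Lambda$ with $1_\Lambda\in M$. A matching is a relation $\{(\beta,f(\beta)):\beta\in\Lambda\}$ for a bijection $f:\Lambda\to\Lambda'$. For a partial coherent configuration with fibers $\Delta_x$ indexed by $x$ in some index set, let $M(x,y)$ be its elements contained in $\Delta_x\times\Delta_y$ and $x\approx y$ mean that $M(x,y)$ partitions $\Delta_x\times\Delta_y$ into matchings; it is a matching configuration if for all $x,y$ with $M(x,y)\neq\varnothing$ either $x\approx y$, or $x=y$ and $M(x,x)=\{1_{\Delta_x}\}$; it is saturated if every set of at most $4$ indices has a common $\approx$-neighbour. -}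

module Defs where

open import Data.Nat using (ℕ; zero; suc; _+_; _≤_)
open import Data.Nat.Properties using () renaming (_≟_ to _≟ℕ_)
open import Data.Bool using (Bool; true; false; _∧_; _∨_; not; if_then_else_)
open import Data.Fin using (Fin; _≟_)
open import Data.List using (List; map; allFin)
open import Data.Bool.ListAction using (all; any)
open import Data.Nat.ListAction using (sum)
open import Data.Product using (Σ; ∃; ∃₂; _×_; _,_)
open import Data.Sum using (_⊎_)
open import Relation.Nullary using (¬_)
open import Relation.Nullary.Decidable using (⌊_⌋)
open import Relation.Binary.PropositionalEquality using (_≡_)
open import Function.Bundles using (_⇔_)
open import Level using () renaming (suc to lsuc; zero to lzero)

Subset : ℕ → Set
Subset n = Fin n → Bool

Rel : ℕ → Set
Rel n = Fin n → Fin n → Bool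

count : ∀ {n} → (Fin n → Bool) → ℕ
count {zero}  p = 0
count {suc n} p = (if p Fin.zero then 1 else 0) + count {n} (λ i → p (Fin.suc i))
  where import Data.Fin as Fin

sumFin : ∀ {m} → (Fin m → ℕ) → ℕ
sumFin {m} f = sum (map f (allFin m))

module _ {n : ℕ} where

  _≐_ : Rel n → Rel n → Set
  ρ ≐ σ = ∀ β γ → ρ β γ ≡ σ β γ

  _≐₁_ : Subset n → Subset n → Set
  Λ ≐₁ Λ' = ∀ β → Λ β ≡ Λ' β

  _⊆_ : Rel n → Rel n → Set
  ρ ⊆ σ = ∀ β γ → ρ β γ ≡ true → σ β γ ≡ true

  _⊆ᵇ_ : Rel n → Rel n → Bool
  ρ ⊆ᵇ σ = all (λ β → all (λ γ → not (ρ β γ) ∨ σ β γ) (allFin n)) (allFin n)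

  _ᵀ : Rel n → Rel n
  (ρ ᵀ) β γ = ρ γ β

  _⨾_ : Rel n → Rel n → Rel n
  (ρ ⨾ σ) β δ = any (λ γ → ρ β γ ∧ σ γ δ) (allFin n)

  diagOn : Subset n → Rel n
  diagOn Λ β γ = Λ β ∧ ⌊ β ≟ γ ⌋

  -- |β r ∩ γ s*|  (δ ∈ γ s*  iff  (δ,γ) ∈ s)
  cnum : Rel n → Rel n → Fin n → Fin n → ℕ
  cnum r s β γ = count (λ δ → r β δ ∧ s δ γ)

  RelSet : Set₁
  RelSet = Rel n → Set

  _·ˢ_ : RelSet → RelSet → RelSet
  (R ·ˢ R') τ = Σ (Rel n) λ ρ → Σ (Rel n) λ σ → R ρ × R' σ × τ ≐ (ρ ⨾ σ)

  IsUnionOf : RelSet → Rel n → Set₁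
  IsUnionOf R ρ = Σ RelSet λ P →
    (∀ τ → P τ → R τ) ×
    (∀ β γ → (ρ β γ ≡ true) ⇔ (Σ (Rel n) λ τ → P τ × τ β γ ≡ true))

  -- matching: graph of a bijection between its domain Λ and its range Λ'
  IsMatching : Rel n → Set
  IsMatching ρ =
    (∀ β γ γ' → ρ β γ ≡ true → ρ β γ' ≡ true → γ ≡ γ') ×
    (∀ β β' γ → ρ β γ ≡ true → ρ β' γ ≡ true → β ≡ β')

  record IsPartialCC (Δ : Subset n) (M : RelSet) : Set₁ where
    field
      inside    : ∀ ρ → M ρ → ∀ β γ → ρ β γ ≡ true → (Δ β ≡ true) × (Δ γ ≡ true)
      nonempty  : ∀ ρ → M ρ → ∃₂ λ β γ → ρ β γ ≡ true
      disjoint  : ∀ ρ σ → M ρ → M σ → ∀ β γ →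
                  ρ β γ ≡ true → σ β γ ≡ true → ρ ≐ σ
      diagonal  : IsUnionOf M (diagOn Δ)
      converse  : ∀ ρ → M ρ → Σ (Rel n) λ σ → M σ × σ ≐ (ρ ᵀ)
      coherent  : ∀ r s t → M r → M s → M t → ∀ β γ β' γ' →
                  t β γ ≡ true → t β' γ' ≡ true → cnum r s β γ ≡ cnum r s β' γ'

  IsFiber : RelSet → Subset n → Set
  IsFiber M Λ = Σ (Rel n) λ ρ → M ρ × ρ ≐ diagOn Λ

  module _ {J : Set} (M : RelSet) (Idx : J → Set) (F : J → Subset n) where

    Mof : J → J → RelSet
    Mof x y ρ = M ρ × (∀ β γ → ρ β γ ≡ true → (F x β ≡ true) × (F y γ ≡ true))

    _≈_ : J → J → Set
    x ≈ y = (∀ ρ → Mof x y ρ → IsMatching ρ) ×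
            (∀ β γ → F x β ≡ true → F y γ ≡ true →
               Σ (Rel n) λ ρ → Mof x y ρ × ρ β γ ≡ true)

  record IsSaturatedMatchingConfig {J : Set} (Δ : Subset n) (M : RelSet)
           (Idx : J → Set) (F : J → Subset n) : Set₁ where
    field
      partialCC   : IsPartialCC Δ M
      fibers      : ∀ Λ → IsFiber M Λ ⇔ (Σ J λ x → Idx x × Λ ≐₁ F x)
      indexing    : ∀ x y → Idx x → Idx y → F x ≐₁ F y → x ≡ y
      matching    : ∀ x y → Idx x → Idx y →
                    (Σ (Rel n) λ ρ → Mof M Idx F x y ρ) →
                    _≈_ M Idx F x y ⊎
                    (x ≡ y × (∀ ρ → Mof M Idx F x x ρ → ρ ≐ diagOn (F x))
                           × Mof M Idx F x x (diagOn (F x)))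
      saturated   : ∀ x₁ x₂ x₃ x₄ → Idx x₁ → Idx x₂ → Idx x₃ → Idx x₄ →
                    Σ J λ z → Idx z ×
                      _≈_ M Idx F x₁ z × _≈_ M Idx F x₂ z ×
                      _≈_ M Idx F x₃ z × _≈_ M Idx F x₄ z

-- Coherent configurations: S is given as a colouring col : Ω × Ω → Fin m,
-- the basis relations being the colour classes  rel col i.

module _ {n m : ℕ} (col : Fin n → Fin n → Fin m) where

  rel : Fin m → Rel n
  rel i β γ = ⌊ col β γ ≟ i ⌋

  IsDiag : Fin m → Set
  IsDiag i = ∀ β γ → (col β γ ≡ i) ⇔ (β ≡ γ)

  record IsHomogeneousCC : Set where
    field
      nonempty  : ∀ i → ∃₂ λ β γ → col β γ ≡ i
      diagonal  : ∃ λ e → IsDiag e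
      converse  : ∀ i → ∃ λ j → ∀ β γ → (col β γ ≡ i) ⇔ (col γ β ≡ j)
      coherent  : ∀ r s t β γ β' γ' → col β γ ≡ t → col β' γ' ≡ t →
                  cnum (rel r) (rel s) β γ ≡ cnum (rel r) (rel s) β' γ'

  valency : Fin m → Fin n → ℕ
  valency s β = count (rel s β)

  IsMaxValency : ℕ → Set
  IsMaxValency k = (∀ s β → valency s β ≤ k) × (∃₂ λ s β → valency s β ≡ k)

  -- Σ_{s ∈ S} c_{s s*}^r, evaluated at (β,γ) ∈ r
  indistSum : Fin n → Fin n → ℕ
  indistSum β γ = sumFin (λ s → cnum (rel s) (rel s ᵀ) β γ)

  IsIndistinguishingNumber : ℕ → Set
  IsIndistinguishingNumber c =
    (∀ r → ¬ IsDiag r → ∀ β γ → col β γ ≡ r → indistSum β γ ≤ c) ×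
    (Σ (Fin m) λ r → ¬ IsDiag r × ∃₂ λ β γ → col β γ ≡ r × indistSum β γ ≡ c)

  module _ (k : ℕ) (α : Fin n) where

    inX : Fin m → Set
    inX x = valency x α ≡ k

    inXᵇ : Fin m → Bool
    inXᵇ x = ⌊ valency x α ≟ℕ k ⌋

    ∣X∣ : ℕ
    ∣X∣ = count inXᵇ

    inProdᵇ : Fin m → Fin m → Fin m → Bool
    inProdᵇ x y r = rel r ⊆ᵇ ((rel x ᵀ) ⨾ rel y)

    _∼_ : Fin m → Fin m → Set
    x ∼ y = count (inProdᵇ x y) ≡ k

    fiber : Fin m → Subset n
    fiber x = rel x α

    Δα : Subset n
    Δα β = inXᵇ (col α β)

    restr : Fin m → Fin m → Fin m → Rel n
    restr r x y β γ = rel r β γ ∧ (fiber x β ∧ fiber y γ)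

    Sα : Fin m → Fin m → RelSet
    Sα x y ρ = Σ (Fin m) λ r → inProdᵇ x y r ≡ true × ρ ≐ restr r x y

    Mα⟨_,_⟩ : Fin m → Fin m → RelSet
    Mα⟨ x , y ⟩ ρ = (x ∼ y × Sα x y ρ) ⊎ (¬ (x ∼ y) × x ≡ y × ρ ≐ diagOn (fiber x))

    Mα : RelSet
    Mα ρ = Σ (Fin m) λ x → Σ (Fin m) λ y → inX x × inX y × Mα⟨ x , y ⟩ ρ

{-# OPTIONS --safe #-}

-- The elements of M_α are the classes ("cells") of pairs (β,γ) with the same colours of αβ, αγ and βγ,
-- and x ∼ y means that for β ∈ αx the colour of βγ determines γ ∈ αy; so every cell is a matching.
--
-- Composition of matchings: let βγ and γδ be linked, and let (β',γ',δ') have the same colours as (β,γ,δ)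
-- except possibly on βδ. Call μ generic if it distinguishes, by its colours, certain pairs of points drawn
-- from three families of at most k² pairs; each pair is confused by at most c points, so a generic μ exists
-- as soon as 3k²c < n, which follows from 6c(k - 1) < |X| and k|X| ≤ n. Copy μ over the edge αγ to a point μ'
-- over αγ'. Genericity forces β'μ' and βμ, then δ'μ' and δμ, and finally β'δ' and βδ to have equal colours.
--
-- Saturation: for β ∈ αx, an index z with x ≁ z yields a point of αz confusing β with another
-- point of αx; there are at most c(k - 1) such points, hence at most 4c(k - 1) < |X| bad z for four indices.

module Submission where

open import Defs
open import Data.Bool using (Bool; true; false; _∧_; _∨_; not; if_then_else_)
open import Data.Bool.ListAction using (all; any)
open import Data.Bool.Properties using (T-≡; ∧-conicalˡ; ∧-conicalʳ; ⇔→≡)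
open import Data.Fin using (Fin; zero; suc; _≟_)
open import Data.Fin.Properties using (suc-injective)
open import Data.List using (allFin; tabulate)
open import Data.List.Properties using (map-tabulate)
import Data.List.Relation.Unary.All.Properties as All
import Data.List.Relation.Unary.Any.Properties as Any
open import Data.Nat using (ℕ; zero; suc; _+_; _*_; _∸_; _≤_; _<_; z≤n; s≤s; _<?_)
import Data.Nat.ListAction as ListAction
open import Data.Nat.Properties hiding (_≟_; suc-injective)
open import Data.Nat.Properties using () renaming (_≟_ to _≟ℕ_)
open import Data.Nat.Tactic.RingSolver using (solve-∀)
open import Data.Product using (Σ; ∃; ∃₂; _×_; _,_; proj₁; proj₂)
open import Data.Sum using (_⊎_; inj₁; inj₂)
open import Function using (_∘_; const; id; case_of_)
open import Function.Bundles using (Equivalence; mk⇔; _⇔_)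
open import Relation.Binary.PropositionalEquality
open import Relation.Nullary using (¬_; Dec; yes; no; contradiction)
open import Relation.Nullary.Decidable using (⌊_⌋; toWitness; fromWitness)

open import Algebra.Properties.Semiring.Sum +-*-semiring
  using (sum; sum-cong-≗; ∑-comm; ∑-distrib-+; *-distribˡ-sum; *-distribʳ-sum)

-- Reflection of Boolean tests

⌊⌋⁻ : ∀ {a} {A : Set a} {d : Dec A} → ⌊ d ⌋ ≡ true → A
⌊⌋⁻ e = toWitness (Equivalence.from T-≡ e)

⌊⌋⁺ : ∀ {a} {A : Set a} {d : Dec A} → A → ⌊ d ⌋ ≡ true
⌊⌋⁺ x = Equivalence.to T-≡ (fromWitness x)

not⌊⌋⁺ : ∀ {a} {A : Set a} {d : Dec A} → ¬ A → not ⌊ d ⌋ ≡ true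
not⌊⌋⁺ {d = yes x} ¬x = contradiction x ¬x
not⌊⌋⁺ {d = no _}  _  = refl

not⌊⌋⁻ : ∀ {a} {A : Set a} {d : Dec A} → not ⌊ d ⌋ ≡ true → ¬ A
not⌊⌋⁻ {d = no ¬x} _ = ¬x

∧⁺ : ∀ {a b} → a ≡ true → b ≡ true → a ∧ b ≡ true
∧⁺ refl refl = refl

∧⁻ : ∀ {a b} → a ∧ b ≡ true → a ≡ true × b ≡ true
∧⁻ {a} {b} e = ∧-conicalˡ a b e , ∧-conicalʳ a b e

⇒⁺ : ∀ {a b} → (a ≡ true → b ≡ true) → not a ∨ b ≡ true
⇒⁺ {false} _ = refl
⇒⁺ {true}  f = f refl

⇒⁻ : ∀ {a b} → not a ∨ b ≡ true → a ≡ true → b ≡ true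
⇒⁻ e refl = e

module _ {n : ℕ} where

  all-allFin⁺ : (p : Fin n → Bool) → (∀ i → p i ≡ true) → all p (allFin n) ≡ true
  all-allFin⁺ p h = Equivalence.to T-≡ (All.all⁻ p (All.tabulate⁺ (Equivalence.from T-≡ ∘ h)))

  all-allFin⁻ : (p : Fin n → Bool) → all p (allFin n) ≡ true → ∀ i → p i ≡ true
  all-allFin⁻ p e i = Equivalence.to T-≡ (All.tabulate⁻ (All.all⁺ p _ (Equivalence.from T-≡ e)) i)

  any-allFin⁺ : (p : Fin n → Bool) → ∀ i → p i ≡ true → any p (allFin n) ≡ true
  any-allFin⁺ p i e = Equivalence.to T-≡ (Any.any⁺ p (Any.tabulate⁺ i (Equivalence.from T-≡ e)))

  any-allFin⁻ : (p : Fin n → Bool) → any p (allFin n) ≡ true → ∃ λ i → p i ≡ true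
  any-allFin⁻ p e with Any.tabulate⁻ (Any.any⁻ p _ (Equivalence.from T-≡ e))
  ... | i , t = i , Equivalence.to T-≡ t

  ⊆ᵇ⁺ : (ρ σ : Rel n) → ρ ⊆ σ → ρ ⊆ᵇ σ ≡ true
  ⊆ᵇ⁺ _ _ h = all-allFin⁺ _ λ β → all-allFin⁺ _ λ γ → ⇒⁺ (h β γ)

  ⊆ᵇ⁻ : (ρ σ : Rel n) → ρ ⊆ᵇ σ ≡ true → ρ ⊆ σ
  ⊆ᵇ⁻ _ _ e β γ = ⇒⁻ (all-allFin⁻ _ (all-allFin⁻ _ e β) γ)

  ⨾⁺ : (ρ σ : Rel n) {β γ δ : Fin n} → ρ β γ ≡ true → σ γ δ ≡ true → (ρ ⨾ σ) β δ ≡ true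
  ⨾⁺ _ _ {γ = γ} e f = any-allFin⁺ _ γ (∧⁺ e f)

  ⨾⁻ : (ρ σ : Rel n) {β δ : Fin n} → (ρ ⨾ σ) β δ ≡ true → ∃ λ γ → ρ β γ ≡ true × σ γ δ ≡ true
  ⨾⁻ _ _ e with any-allFin⁻ _ e
  ... | γ , f = γ , ∧⁻ f

  ⊆-antisym : {ρ σ : Rel n} → ρ ⊆ σ → σ ⊆ ρ → ρ ≐ σ
  ⊆-antisym h h' β γ = ⇔→≡ (mk⇔ (h β γ) (h' β γ))

-- Finite sums and counting

⟦_⟧ : Bool → ℕ
⟦ b ⟧ = if b then 1 else 0

⟦⟧-mono : ∀ {a b} → (a ≡ true → b ≡ true) → ⟦ a ⟧ ≤ ⟦ b ⟧
⟦⟧-mono {false} _ = z≤n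
⟦⟧-mono {true}  f rewrite f refl = ≤-refl

count≡sum : ∀ {n} (p : Fin n → Bool) → count p ≡ sum (⟦_⟧ ∘ p)
count≡sum {zero}  p = refl
count≡sum {suc n} p = cong (⟦ p zero ⟧ +_) (count≡sum (p ∘ suc))

sum-mono : ∀ {n} {f g : Fin n → ℕ} → (∀ i → f i ≤ g i) → sum f ≤ sum g
sum-mono {zero}  h = z≤n
sum-mono {suc n} h = +-mono-≤ (h zero) (sum-mono (h ∘ suc))

term≤sum : ∀ {n} (f : Fin n → ℕ) i → f i ≤ sum f
term≤sum f zero    = m≤m+n _ _
term≤sum f (suc i) = ≤-trans (term≤sum (f ∘ suc) i) (m≤n+m _ _)

-- If the reverse inequality held at every index, summing it would contradict the hypothesis. Both
-- the generic point and the common neighbour are found by this averaging argument.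
sum-<⇒∃< : ∀ {n} {f g : Fin n → ℕ} → sum f < sum g → ∃ λ i → f i < g i
sum-<⇒∃< {suc n} {f} {g} lt with f zero <? g zero
... | yes f₀<g₀ = zero , f₀<g₀
... | no  f₀≮g₀ with sum (f ∘ suc) <? sum (g ∘ suc)
...   | yes lt' = let i , fi<gi = sum-<⇒∃< lt' in suc i , fi<gi
...   | no  ≮'  = contradiction (+-mono-≤ (≮⇒≥ f₀≮g₀) (≮⇒≥ ≮')) (<⇒≱ lt)

sum-1 : ∀ n → sum {n} (const 1) ≡ n
sum-1 zero    = refl
sum-1 (suc n) = cong suc (sum-1 n)

sumFin≡sum : ∀ {m} (f : Fin m → ℕ) → sumFin f ≡ sum f
sumFin≡sum f = trans (cong ListAction.sum (map-tabulate id f)) (go f)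
  where
  go : ∀ {m} (f : Fin m → ℕ) → ListAction.sum (tabulate f) ≡ sum f
  go {zero}  f = refl
  go {suc m} f = cong (f zero +_) (go (f ∘ suc))

sum-bound : ∀ {n d} (P : Fin n → Bool) (f : Fin n → ℕ) →
            (∀ i → f i ≤ ⟦ P i ⟧ * d) → sum f ≤ count P * d
sum-bound {d = d} P f h = begin
  sum f                          ≤⟨ sum-mono h ⟩
  sum (λ i → ⟦ P i ⟧ * d)        ≡⟨ *-distribʳ-sum d (⟦_⟧ ∘ P) ⟨
  sum (⟦_⟧ ∘ P) * d              ≡⟨ cong (_* d) (count≡sum P) ⟨
  count P * d                    ∎
  where open ≤-Reasoning

module _ {n : ℕ} where

  1≤count : (p : Fin n → Bool) → ∀ i → p i ≡ true → 1 ≤ count p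
  1≤count p i e = begin
    1               ≡⟨ cong ⟦_⟧ e ⟨
    ⟦ p i ⟧         ≤⟨ term≤sum (⟦_⟧ ∘ p) i ⟩
    sum (⟦_⟧ ∘ p)   ≡⟨ count≡sum p ⟨
    count p         ∎
    where open ≤-Reasoning

count≥1⇒∃ : ∀ {n} (p : Fin n → Bool) → 1 ≤ count p → ∃ λ i → p i ≡ true
count≥1⇒∃ {suc n} p h with p zero in eq
... | true  = zero , eq
... | false = let i , e = count≥1⇒∃ (p ∘ suc) h in suc i , e

count-none : ∀ {n} (p : Fin n → Bool) → ¬ (∃ λ i → p i ≡ true) → count p ≡ 0
count-none p h with count p in eq
... | zero  = refl
... | suc _ = contradiction (count≥1⇒∃ p (subst (1 ≤_) (sym eq) (s≤s z≤n))) h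

count≤1 : ∀ {n} (p : Fin n → Bool) → (∀ i j → p i ≡ true → p j ≡ true → i ≡ j) → count p ≤ 1
count≤1 {zero}  p h = z≤n
count≤1 {suc n} p h with p zero in eq
... | false = count≤1 (p ∘ suc) λ i j a b → suc-injective (h _ _ a b)
... | true  = ≤-reflexive (cong suc (count-none (p ∘ suc) λ (i , e) → case h zero (suc i) eq e of λ ()))

module _ {a b : ℕ} where

  -- Double counting of the pairs in `R`: every row in `p` holds at least one pair, every column at
  -- most one, and columns outside `q` none. A relation is used instead of a function so that
  -- injections and surjections are both instances.
  count-rel : (p : Fin a → Bool) (q : Fin b → Bool) (R : Fin a → Fin b → Bool) →
              (∀ i → p i ≡ true → ∃ λ j → R i j ≡ true) →
              (∀ i j → R i j ≡ true → q j ≡ true) →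
              (∀ i i' j → R i j ≡ true → R i' j ≡ true → i ≡ i') →
              count p ≤ count q
  count-rel p q R total range inj = begin
    count p                               ≡⟨ count≡sum p ⟩
    sum (⟦_⟧ ∘ p)                         ≤⟨ sum-mono row ⟩
    sum (λ i → sum (λ j → ⟦ R i j ⟧))     ≡⟨ ∑-comm (λ i j → ⟦ R i j ⟧) ⟩
    sum (λ j → sum (λ i → ⟦ R i j ⟧))     ≤⟨ sum-mono column ⟩
    sum (⟦_⟧ ∘ q)                         ≡⟨ count≡sum q ⟨
    count q                               ∎
    where
    open ≤-Reasoning
    row : ∀ i → ⟦ p i ⟧ ≤ sum (λ j → ⟦ R i j ⟧)
    row i with p i in eq
    ... | false = z≤n
    ... | true  = let j , e = total i eq in subst (1 ≤_) (count≡sum (R i)) (1≤count (R i) j e)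
    column : ∀ j → sum (λ i → ⟦ R i j ⟧) ≤ ⟦ q j ⟧
    column j with q j in eq
    ... | true  = subst (_≤ 1) (count≡sum (λ i → R i j)) (count≤1 _ λ i i' → inj i i' j)
    ... | false = ≤-reflexive (trans (sym (count≡sum (λ i → R i j)))
                    (count-none _ λ (i , e) → case trans (sym eq) (range i j e) of λ ()))

  count-injection : (p : Fin a → Bool) (q : Fin b → Bool) (f : Fin a → Fin b) →
                    (∀ i → p i ≡ true → q (f i) ≡ true) →
                    (∀ i i' → p i ≡ true → p i' ≡ true → f i ≡ f i' → i ≡ i') →
                    count p ≤ count q
  count-injection p q f into inj = count-rel p q (λ i j → p i ∧ ⌊ f i ≟ j ⌋)
    (λ i pi → f i , ∧⁺ pi (⌊⌋⁺ refl))
    (λ i j e → let pi , fi = ∧⁻ e in subst (λ j → q j ≡ true) (⌊⌋⁻ fi) (into i pi))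
    (λ i i' j e e' → let pi , fi = ∧⁻ e ; pi' , fi' = ∧⁻ e' in
       inj i i' pi pi' (trans (⌊⌋⁻ fi) (sym (⌊⌋⁻ fi'))))

  count-surjection : (p : Fin a → Bool) (q : Fin b → Bool) (f : Fin b → Fin a) →
                     (∀ i → p i ≡ true → ∃ λ j → q j ≡ true × f j ≡ i) →
                     count p ≤ count q
  count-surjection p q f onto = count-rel p q (λ i j → q j ∧ ⌊ f j ≟ i ⌋)
    (λ i pi → let j , qj , fj = onto i pi in j , ∧⁺ qj (⌊⌋⁺ fj))
    (λ i j → ∧-conicalˡ (q j) _)
    (λ i i' j e e' → trans (sym (⌊⌋⁻ (∧-conicalʳ (q j) _ e))) (⌊⌋⁻ (∧-conicalʳ (q j) _ e')))

module _ {n : ℕ} where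

  count-mono : (p q : Fin n → Bool) → (∀ i → p i ≡ true → q i ≡ true) → count p ≤ count q
  count-mono p q h = count-injection p q id h (λ _ _ _ _ → id)

  2≤count : (p : Fin n → Bool) → ∀ i j → p i ≡ true → p j ≡ true → i ≢ j → 2 ≤ count p
  2≤count p i j pi pj i≢j = count-injection {2} (const true) p pick into inj
    where
    pick : Fin 2 → Fin n
    pick zero       = i
    pick (suc zero) = j
    into : ∀ u → true ≡ true → p (pick u) ≡ true
    into zero       _ = pi
    into (suc zero) _ = pj
    inj : ∀ u v → true ≡ true → true ≡ true → pick u ≡ pick v → u ≡ v
    inj zero       zero       _ _ _ = refl
    inj zero       (suc zero) _ _ e = contradiction e i≢j
    inj (suc zero) zero       _ _ e = contradiction (sym e) i≢j
    inj (suc zero) (suc zero) _ _ _ = refl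

_∖_ : ∀ {n} → (Fin n → Bool) → Fin n → Fin n → Bool
(p ∖ i) j = p j ∧ not ⌊ i ≟ j ⌋

-- `withTrue` adjoins one extra element to `p ∖ i`. Sending it to `i` keeps the map injective, and
-- the extra element makes the inequality strict.
count-∖-< : ∀ {n} (p : Fin n → Bool) i → p i ≡ true → count (p ∖ i) < count p
count-∖-< {n} p i pi = count-injection withTrue p f into inj
  where
  withTrue : Fin (suc n) → Bool
  withTrue zero    = true
  withTrue (suc j) = (p ∖ i) j
  f : Fin (suc n) → Fin n
  f zero    = i
  f (suc j) = j
  into : ∀ j → withTrue j ≡ true → p (f j) ≡ true
  into zero    _ = pi
  into (suc j) e = ∧-conicalˡ (p j) _ e
  inj : ∀ j j' → withTrue j ≡ true → withTrue j' ≡ true → f j ≡ f j' → j ≡ j'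
  inj zero    zero     _ _  _    = refl
  inj zero    (suc j') _ e' i≡j' = contradiction i≡j' (not⌊⌋⁻ (∧-conicalʳ (p j') _ e'))
  inj (suc j) zero     e _  j≡i  = contradiction (sym j≡i) (not⌊⌋⁻ (∧-conicalʳ (p j) _ e))
  inj (suc j) (suc j') _ _  j≡j' = cong suc j≡j'

-- Equality of relations and diagonals

module _ {n : ℕ} where

  ≐⁺ : {ρ σ : Rel n} → ρ ≐ σ → ∀ β γ → σ β γ ≡ true → ρ β γ ≡ true
  ≐⁺ e β γ = trans (e β γ)

  ≐⁻ : {ρ σ : Rel n} → ρ ≐ σ → ∀ β γ → ρ β γ ≡ true → σ β γ ≡ true
  ≐⁻ e β γ = trans (sym (e β γ))

  diagOn⁺ : (Λ : Subset n) → ∀ {β γ} → Λ β ≡ true → β ≡ γ → diagOn Λ β γ ≡ true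
  diagOn⁺ Λ e f = ∧⁺ e (⌊⌋⁺ f)

  diagOn⁻ : (Λ : Subset n) → ∀ {β γ} → diagOn Λ β γ ≡ true → Λ β ≡ true × β ≡ γ
  diagOn⁻ Λ {β} {γ} e = ∧-conicalˡ _ _ e , ⌊⌋⁻ {d = β ≟ γ} (∧-conicalʳ (Λ β) _ e)

  diagOn-injective : {Λ Λ' : Subset n} → diagOn Λ ≐ diagOn Λ' → Λ ≐₁ Λ'
  diagOn-injective {Λ} {Λ'} e β = ⇔→≡ (mk⇔
    (λ h → proj₁ (diagOn⁻ Λ' (≐⁻ e β β (diagOn⁺ Λ h refl))))
    (λ h → proj₁ (diagOn⁻ Λ (≐⁺ e β β (diagOn⁺ Λ' h refl)))))

-- Confused pairs of points

module _ {n m : ℕ} (col : Fin n → Fin n → Fin m) where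

  rel⁺ : ∀ {i} β γ → col β γ ≡ i → rel col i β γ ≡ true
  rel⁺ {i} β γ = ⌊⌋⁺ {d = col β γ ≟ i}

  rel⁻ : ∀ {i} β γ → rel col i β γ ≡ true → col β γ ≡ i
  rel⁻ {i} β γ = ⌊⌋⁻ {d = col β γ ≟ i}

  -- The points `μ` that fail to tell `p` from `q`; for distinct `p` and `q` the indistinguishing
  -- number bounds how many there are.
  agreement : Fin n → Fin n → Fin n → Bool
  agreement p q μ = ⌊ col p μ ≟ col q μ ⌋

  -- `p` is removed from `Q` because it agrees with itself at every `μ`; the value is zero exactly
  -- when `μ` tells `p` from all other points of `Q`.
  confusion : Fin n → Subset n → Fin n → ℕ
  confusion p Q μ = count λ q → (Q ∖ p) q ∧ agreement p q μ

  confusion-none : ∀ p Q μ → confusion p Q μ < 1 → ∀ q → Q q ≡ true → col p μ ≡ col q μ → p ≡ q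
  confusion-none p Q μ none q Qq e with p ≟ q
  ... | yes p≡q = p≡q
  ... | no  p≢q = contradiction (1≤count _ q (∧⁺ (∧⁺ Qq (not⌊⌋⁺ p≢q)) (⌊⌋⁺ e))) (<⇒≱ none)

  colour-count≤1 : ∀ β γ → count (λ x → rel col x β γ) ≤ 1
  colour-count≤1 β γ = count≤1 _ λ x y e f → trans (sym (rel⁻ β γ e)) (rel⁻ β γ f)

  -- A point `δ` at which `p` and `q` agree is counted in the summand of its common colour
  -- `s = col p δ`.
  agreement≤indistSum : ∀ p q → count (agreement p q) ≤ indistSum col p q
  agreement≤indistSum p q = begin
    count (agreement p q)                   ≡⟨ count≡sum (agreement p q) ⟩
    sum (⟦_⟧ ∘ agreement p q)               ≤⟨ sum-mono pointwise ⟩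
    sum (λ δ → sum (λ s → ⟦ both s δ ⟧))    ≡⟨ ∑-comm (λ δ s → ⟦ both s δ ⟧) ⟩
    sum (λ s → sum (λ δ → ⟦ both s δ ⟧))    ≡⟨ sum-cong-≗ (λ s → count≡sum (both s)) ⟨
    sum (λ s → count (both s))              ≡⟨ sumFin≡sum (λ s → count (both s)) ⟨
    indistSum col p q                       ∎
    where
    open ≤-Reasoning
    both : Fin m → Subset n
    both s δ = rel col s p δ ∧ rel col s q δ
    pointwise : ∀ δ → ⟦ agreement p q δ ⟧ ≤ sum (λ s → ⟦ both s δ ⟧)
    pointwise δ = ≤-trans
      (⟦⟧-mono (λ e → ∧⁺ (⌊⌋⁺ {d = col p δ ≟ col p δ} refl) (⌊⌋⁺ (sym (⌊⌋⁻ e)))))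
      (term≤sum (λ s → ⟦ both s δ ⟧) (col p δ))

  -- A whole family of pairs at once: for each `a` in `P`, the point `h a` against the set `R a`. In
  -- the applications `h` is the identity or a constant.
  confusions : (Fin n → Fin n) → Subset n → Rel n → Fin n → ℕ
  confusions h P R μ = sum λ a → ⟦ P a ⟧ * confusion (h a) (R a) μ

  confusions-none : ∀ h P R μ → confusions h P R μ < 1 → ∀ a q → P a ≡ true → R a q ≡ true →
                    col (h a) μ ≡ col q μ → h a ≡ q
  confusions-none h P R μ none a q Pa = confusion-none (h a) (R a) μ
    (subst (_< 1) (trans (cong (λ b → ⟦ b ⟧ * _) Pa) (*-identityˡ _)) (≤-<-trans (term≤sum _ a) none)) q

  module _ {c : ℕ} (agreement≤c : ∀ p q → p ≢ q → count (agreement p q) ≤ c) where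

    -- Exchanging the sums over `μ` and `q` leaves, for each `q` in `Q` other than `p`, the at most
    -- `c` points that confuse it with `p`.
    sum-confusion : ∀ p Q → sum (confusion p Q) ≤ count (Q ∖ p) * c
    sum-confusion p Q = begin
      sum (confusion p Q)                      ≡⟨ sum-cong-≗ (λ μ → count≡sum (λ q → pair q μ)) ⟩
      sum (λ μ → sum (λ q → ⟦ pair q μ ⟧))     ≡⟨ ∑-comm (λ μ q → ⟦ pair q μ ⟧) ⟩
      sum (λ q → sum (λ μ → ⟦ pair q μ ⟧))     ≡⟨ sum-cong-≗ (λ q → count≡sum (pair q)) ⟨
      sum (λ q → count (pair q))               ≤⟨ sum-bound (Q ∖ p) _ pointwise ⟩
      count (Q ∖ p) * c                        ∎
      where
      open ≤-Reasoning
      pair : Fin n → Subset n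
      pair q μ = (Q ∖ p) q ∧ agreement p q μ
      pointwise : ∀ q → count (pair q) ≤ ⟦ (Q ∖ p) q ⟧ * c
      pointwise q with (Q ∖ p) q in eq
      ... | false = ≤-reflexive (count-none (λ (μ : Fin n) → false ∧ agreement p q μ) λ ())
      ... | true  = ≤-trans (agreement≤c p q (not⌊⌋⁻ (∧-conicalʳ (Q q) _ eq))) (≤-reflexive (sym (*-identityˡ c)))

    sum-confusions : ∀ {k} h P (R : Rel n) → count P ≤ k → (∀ a → count (R a) ≤ k) → sum (confusions h P R) ≤ k * (k * c)
    sum-confusions {k} h P R P≤k R≤k = begin
      sum (confusions h P R)
        ≡⟨ ∑-comm (λ μ a → ⟦ P a ⟧ * confusion (h a) (R a) μ) ⟩
      sum (λ a → sum (λ μ → ⟦ P a ⟧ * confusion (h a) (R a) μ))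
        ≡⟨ sum-cong-≗ (λ a → *-distribˡ-sum ⟦ P a ⟧ (confusion (h a) (R a))) ⟨
      sum (λ a → ⟦ P a ⟧ * sum (confusion (h a) (R a)))
        ≤⟨ sum-bound P _ (λ a → *-monoʳ-≤ ⟦ P a ⟧ (inner a)) ⟩
      count P * (k * c)
        ≤⟨ *-monoˡ-≤ (k * c) P≤k ⟩
      k * (k * c) ∎
      where
      open ≤-Reasoning
      inner : ∀ a → sum (confusion (h a) (R a)) ≤ k * c
      inner a = ≤-trans (sum-confusion (h a) (R a)) (*-monoˡ-≤ c (≤-trans
        (count-mono _ _ (λ q → ∧-conicalˡ (R a q) _)) (R≤k a)))

  -- Fibers and cells around a fixed point

  module _ (k : ℕ) (α : Fin n) where

    -- The fibers `α x` with `x` in `X` have `k` points each, and they are disjoint because a pair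
    -- has only one colour.
    X*k≤n : ∣X∣ col k α * k ≤ n
    X*k≤n = begin
      ∣X∣ col k α * k                                    ≡⟨ cong (_* k) (count≡sum (inXᵇ col k α)) ⟩
      sum (λ x → ⟦ inXᵇ col k α x ⟧) * k                 ≡⟨ *-distribʳ-sum k (λ x → ⟦ inXᵇ col k α x ⟧) ⟩
      sum (λ x → ⟦ inXᵇ col k α x ⟧ * k)                 ≤⟨ sum-mono pointwise ⟩
      sum (λ x → valency col x α)                        ≡⟨ sum-cong-≗ (λ x → count≡sum (rel col x α)) ⟩
      sum (λ x → sum (λ β → ⟦ rel col x α β ⟧))          ≡⟨ ∑-comm (λ x β → ⟦ rel col x α β ⟧) ⟩
      sum (λ β → sum (λ x → ⟦ rel col x α β ⟧))          ≡⟨ sum-cong-≗ (λ β → count≡sum (λ x → rel col x α β)) ⟨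
      sum (λ β → count (λ x → rel col x α β))            ≤⟨ sum-mono (colour-count≤1 α) ⟩
      sum {n} (const 1)                                  ≡⟨ sum-1 n ⟩
      n                                                  ∎
      where
      open ≤-Reasoning
      pointwise : ∀ x → ⟦ inXᵇ col k α x ⟧ * k ≤ valency col x α
      pointwise x with valency col x α ≟ℕ k
      ... | yes e = ≤-reflexive (trans (*-identityˡ k) (sym e))
      ... | no  _ = z≤n

    sum-over-fibers : (D : Fin n → ℕ) → sum (λ z → sum (λ γ → ⟦ fiber col k α z γ ⟧ * D γ)) ≤ sum D
    sum-over-fibers D = begin
      sum (λ z → sum (λ γ → ⟦ fiber col k α z γ ⟧ * D γ))    ≡⟨ ∑-comm (λ z γ → ⟦ fiber col k α z γ ⟧ * D γ) ⟩
      sum (λ γ → sum (λ z → ⟦ fiber col k α z γ ⟧ * D γ))    ≤⟨ sum-mono pointwise ⟩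
      sum D                                                  ∎
      where
      open ≤-Reasoning
      pointwise : ∀ γ → sum (λ z → ⟦ fiber col k α z γ ⟧ * D γ) ≤ D γ
      pointwise γ = begin
        sum (λ z → ⟦ fiber col k α z γ ⟧ * D γ)    ≤⟨ sum-bound (λ z → fiber col k α z γ) _ (λ _ → ≤-refl) ⟩
        count (λ z → fiber col k α z γ) * D γ      ≤⟨ *-monoˡ-≤ (D γ) (colour-count≤1 α γ) ⟩
        1 * D γ                                    ≡⟨ *-identityˡ (D γ) ⟩
        D γ                                        ∎

    -- Parametrized by a pair it contains instead of by three colours, so that elements of M_α can
    -- be handled through representatives.
    cell : Fin n → Fin n → Rel n
    cell β γ = restr col k α (col β γ) (col α β) (col α γ)

    restr⁺ : ∀ {r x y} β γ → col β γ ≡ r → col α β ≡ x → col α γ ≡ y → restr col k α r x y β γ ≡ true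
    restr⁺ β γ βγ αβ αγ = ∧⁺ (rel⁺ β γ βγ) (∧⁺ (rel⁺ α β αβ) (rel⁺ α γ αγ))

    restr⁻ : ∀ {r x y} β γ → restr col k α r x y β γ ≡ true → col β γ ≡ r × col α β ≡ x × col α γ ≡ y
    restr⁻ {r} {x} {y} β γ e =
      let f = ∧-conicalʳ (rel col r β γ) _ e
      in rel⁻ β γ (∧-conicalˡ _ _ e) , rel⁻ α β (∧-conicalˡ _ _ f) , rel⁻ α γ (∧-conicalʳ (fiber col k α x β) _ f)

    -- These are the pairs covered by M_α. The alternative `β ≡ γ` supplies the diagonal of every
    -- fiber, whether or not `x ∼ x` holds.
    Linked : Fin n → Fin n → Set
    Linked β γ = inX col k α (col α β) × inX col k α (col α γ) × (_∼_ col k α (col α β) (col α γ) ⊎ β ≡ γ)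

    Δα⁺ : ∀ β → inX col k α (col α β) → Δα col k α β ≡ true
    Δα⁺ β = ⌊⌋⁺ {d = valency col (col α β) α ≟ℕ k}

    Δα⁻ : ∀ β → Δα col k α β ≡ true → inX col k α (col α β)
    Δα⁻ β = ⌊⌋⁻ {d = valency col (col α β) α ≟ℕ k}

    cell-self : ∀ β γ → cell β γ β γ ≡ true
    cell-self β γ = restr⁺ β γ refl refl refl

    cell-cong : ∀ {β γ β' γ'} → col β γ ≡ col β' γ' → col α β ≡ col α β' → col α γ ≡ col α γ' → cell β γ ≐ cell β' γ'
    cell-cong e f g δ ε rewrite e | f | g = refl

    cell-≐ : ∀ {β γ β' γ'} → cell β γ β' γ' ≡ true → cell β γ ≐ cell β' γ'
    cell-≐ {β' = β'} {γ'} e = let f , g , h = restr⁻ β' γ' e in cell-cong (sym f) (sym g) (sym h)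

  -- Copying triangles over edges of equal colour

  module _ (hom : IsHomogeneousCC col) where

    open IsHomogeneousCC hom

    converse-colour : ∀ {β γ β' γ'} → col β γ ≡ col β' γ' → col γ β ≡ col γ' β'
    converse-colour {β} {γ} {β'} {γ'} e = let j , h = converse (col β γ) in
      trans (Equivalence.to (h β γ) refl) (sym (Equivalence.to (h β' γ') (sym e)))

    diagonal-colour : ∀ {β γ δ} → col β γ ≡ col δ δ → β ≡ γ
    diagonal-colour {β} {γ} {δ} e = let _ , h = diagonal in
      Equivalence.to (h β γ) (trans e (Equivalence.from (h δ δ) refl))

    colour-diagonal : ∀ β γ → col β β ≡ col γ γ
    colour-diagonal β γ = let _ , h = diagonal in
      trans (Equivalence.from (h β β) refl) (sym (Equivalence.from (h γ γ) refl))

    -- The intersection number of the colours of `βδ` and `δγ` is positive at `(β,γ)`, hence also at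
    -- every pair of the same colour.
    extend : ∀ {β γ β' γ'} → col β γ ≡ col β' γ' → ∀ δ →
             ∃ λ δ' → col β' δ' ≡ col β δ × col δ' γ' ≡ col δ γ
    extend {β} {γ} {β'} {γ'} e δ =
      let δ' , h = count≥1⇒∃ _ (subst (1 ≤_) (coherent (col β δ) (col δ γ) (col β γ) β γ β' γ' refl (sym e))
                     (1≤count _ δ (∧⁺ (rel⁺ β δ refl) (rel⁺ δ γ refl))))
      in δ' , rel⁻ β' δ' (∧-conicalˡ _ _ h) , rel⁻ δ' γ' (∧-conicalʳ (rel col (col β δ) β' δ') _ h)

    -- The fourth side determined by two triangles

    module _ {k c : ℕ} (valency≤k : ∀ s β → valency col s β ≤ k)
             (agreement≤c : ∀ p q → p ≢ q → count (agreement p q) ≤ c)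
             (large : 3 * (k * (k * c)) < n) where

      -- The last two hypotheses make `β` and `δ` the only points with their colours from `α` and
      -- `γ`. This lets a generic `μ` be used to compare the two triangles on `αγ` with those on
      -- `αγ'`.
      quadrangle : ∀ {α β γ δ β' γ' δ'} →
        col α β' ≡ col α β → col α γ' ≡ col α γ → col α δ' ≡ col α δ →
        col β' γ' ≡ col β γ → col γ' δ' ≡ col γ δ →
        (∀ β₁ → col α β₁ ≡ col α β → col γ β₁ ≡ col γ β → β ≡ β₁) →
        (∀ δ₁ → col α δ₁ ≡ col α δ → col γ δ₁ ≡ col γ δ → δ ≡ δ₁) →
        col β' δ' ≡ col β δ
      quadrangle {α} {β} {γ} {δ} {β'} {γ'} {δ'} x z y r s β-unique δ-unique = βδ
        where
        open ≤-Reasoning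
        -- Pairs to be distinguished: β₁ ∈ αx from β₂ ∈ γr; δ₁ ∈ αy from δ₂ ∈ γs; β from each β₂ ∈ a x with a ∈ δy*.
        αx αy γr γs δy* : Subset n
        αx  = rel col (col α β) α
        αy  = rel col (col α δ) α
        γr  = rel col (col γ β) γ
        γs  = rel col (col γ δ) γ
        δy* = rel col (col δ α) δ

        T₁ T₂ T₃ : Fin n → ℕ
        T₁ = confusions id αx (λ _ → γr)
        T₂ = confusions id αy (λ _ → γs)
        T₃ = confusions (λ _ → β) δy* (rel col (col α β))

        total : sum (λ μ → T₁ μ + (T₂ μ + T₃ μ)) < sum {n} (const 1)
        total = begin-strict
          sum (λ μ → T₁ μ + (T₂ μ + T₃ μ))    ≡⟨ ∑-distrib-+ T₁ (λ μ → T₂ μ + T₃ μ) ⟩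
          sum T₁ + sum (λ μ → T₂ μ + T₃ μ)    ≡⟨ cong (sum T₁ +_) (∑-distrib-+ T₂ T₃) ⟩
          sum T₁ + (sum T₂ + sum T₃)          ≤⟨ +-mono-≤ (sum-confusions agreement≤c id αx (λ _ → γr) (valency≤k _ _) (λ _ → valency≤k _ _))
                                                   (+-mono-≤ (sum-confusions agreement≤c id αy (λ _ → γs) (valency≤k _ _) (λ _ → valency≤k _ _))
                                                             (sum-confusions agreement≤c (λ _ → β) δy* (rel col (col α β)) (valency≤k _ _) (λ _ → valency≤k _ _))) ⟩
          -- `3 * t` unfolds to `t + (t + (t + 0))`, whence the trailing zero.
          k * (k * c) + (k * (k * c) + k * (k * c))  ≡⟨ cong (λ t → k * (k * c) + (k * (k * c) + t)) (sym (+-identityʳ _)) ⟩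
          3 * (k * (k * c))                   <⟨ large ⟩
          n                                   ≡⟨ sum-1 n ⟨
          sum {n} (const 1)                   ∎

        -- The average over all `n` points is below 1, so all three numbers of confused pairs vanish
        -- at some `μ`.
        generic : ∃ λ μ → T₁ μ + (T₂ μ + T₃ μ) < 1
        generic = sum-<⇒∃< total

        μ : Fin n
        μ = proj₁ generic

        T₁<1 : T₁ μ < 1
        T₁<1 = ≤-<-trans (m≤m+n _ _) (proj₂ generic)
        T₂<1 : T₂ μ < 1
        T₂<1 = ≤-<-trans (≤-trans (m≤m+n _ (T₃ μ)) (m≤n+m _ (T₁ μ))) (proj₂ generic)
        T₃<1 : T₃ μ < 1
        T₃<1 = ≤-<-trans (≤-trans (m≤n+m _ (T₂ μ)) (m≤n+m _ (T₁ μ))) (proj₂ generic)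

        copy : ∃ λ μ' → col α μ' ≡ col α μ × col μ' γ' ≡ col μ γ
        copy = extend (sym z) μ
        μ' : Fin n
        μ' = proj₁ copy
        u : col α μ' ≡ col α μ
        u = proj₁ (proj₂ copy)
        v : col γ' μ' ≡ col γ μ
        v = converse-colour (proj₂ (proj₂ copy))

        βμ : col β' μ' ≡ col β μ
        βμ =
          -- `β'` is copied twice: to `β₁` over the edge `αμ` and to `β₂` over the edge `γμ`. Both
          -- have the same colour to `μ`, so they coincide by genericity; the common point has the
          -- colours of `β` from `α` and `γ`, so it is `β`.
          let β₁ , αβ₁ , β₁μ = extend u β'
              β₂ , γβ₂ , β₂μ = extend v β'
              β₁≡β₂ = confusions-none id αx (λ _ → γr) μ T₁<1 β₁ β₂
                        (⌊⌋⁺ (trans αβ₁ x)) (⌊⌋⁺ (trans γβ₂ (converse-colour r))) (trans β₁μ (sym β₂μ))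
              β≡β₂ = β-unique β₂ (trans (cong (col α) (sym β₁≡β₂)) (trans αβ₁ x)) (trans γβ₂ (converse-colour r))
          in trans (sym β₂μ) (cong (λ t → col t μ) (sym β≡β₂))

        δμ : col δ' μ' ≡ col δ μ
        δμ =
          let δ₁ , αδ₁ , δ₁μ = extend u δ'
              δ₂ , γδ₂ , δ₂μ = extend v δ'
              δ₁≡δ₂ = confusions-none id αy (λ _ → γs) μ T₂<1 δ₁ δ₂
                        (⌊⌋⁺ (trans αδ₁ y)) (⌊⌋⁺ (trans γδ₂ s)) (trans δ₁μ (sym δ₂μ))
              δ≡δ₂ = δ-unique δ₂ (trans (cong (col α) (sym δ₁≡δ₂)) (trans αδ₁ y)) (trans γδ₂ s)
          in trans (sym δ₂μ) (cong (λ t → col t μ) (sym δ≡δ₂))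

        βδ : col β' δ' ≡ col β δ
        βδ =
          -- `β'` is copied over the edge `δμ` to `β₂`, and `α` over `δβ₂` to `α₂`. Thus `β₂`
          -- belongs to the third family and has the colour of `β` to `μ`, which forces `β₂` to be
          -- `β`.
          let β₂ , δβ₂ , β₂μ = extend δμ β'
              α₂ , δα₂ , α₂β₂ = extend (sym δβ₂) α
              β≡β₂ = confusions-none (λ _ → β) δy* (rel col (col α β)) μ T₃<1 α₂ β₂
                        (⌊⌋⁺ (trans δα₂ (converse-colour y))) (⌊⌋⁺ (trans α₂β₂ x)) (sym (trans β₂μ βμ))
          in converse-colour (trans (sym δβ₂) (cong (col δ) (sym β≡β₂)))

    -- The relation `∼` as injectivity of colours

    module _ {k : ℕ} (1<k : 1 < k) (α : Fin n) where

      private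
        infix 4 _~_
        _~_ : Fin m → Fin m → Set
        _~_ = _∼_ col k α
        X : Fin m → Set
        X = inX col k α
        F : Fin m → Subset n
        F = fiber col k α
        M : RelSet {n}
        M = Mα col k α
        L : Fin n → Fin n → Set
        L = Linked k α
        _∈X : Fin n → Set
        β ∈X = X (col α β)

      point : ∀ {x} → X x → ∃ λ β → col α β ≡ x
      point {x} Xx = let β , e = count≥1⇒∃ (F x) (subst (1 ≤_) (sym Xx) (<⇒≤ 1<k)) in β , rel⁻ α β e

      product⁺ : ∀ β γ → inProdᵇ col k α (col α β) (col α γ) (col β γ) ≡ true
      product⁺ β γ = ⊆ᵇ⁺ _ _ λ β' γ' e →
        let α' , βα , αγ = extend (sym (rel⁻ β' γ' e)) α
        in ⨾⁺ (rel col (col α β) ᵀ) (rel col (col α γ)) (rel⁺ α' β' (converse-colour βα)) (rel⁺ α' γ' αγ)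

      -- Some pair of colour `r` closes a triangle of the right colours; copying its endpoint over
      -- the edge `αβ` realizes `r` at the prescribed `β`.
      product⁻ : ∀ {x y r} → inProdᵇ col k α x y r ≡ true → ∀ β → col α β ≡ x →
                 ∃ λ γ → col α γ ≡ y × col β γ ≡ r
      product⁻ {x} {y} {r} e β αβ =
        let β₀ , γ₀ , β₀γ₀ = nonempty r
            α₀ , f , g = ⨾⁻ (rel col x ᵀ) (rel col y) (⊆ᵇ⁻ (rel col r) _ e β₀ γ₀ (rel⁺ β₀ γ₀ β₀γ₀))
            γ , αγ , γβ = extend (trans (rel⁻ α₀ β₀ f) (sym αβ)) γ₀
        in γ , trans αγ (rel⁻ α₀ γ₀ g) , trans (converse-colour γβ) β₀γ₀

      -- The colours seen from `β` map the `k` points of `α y` onto the `k` elements of `x*y`. If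
      -- `γ` and `γ'` had equal colours, the fewer than `k` points other than `γ'` would still reach
      -- all of them.
      ∼⇒injective : ∀ {x y} → X y → x ~ y → ∀ {β γ γ'} → col α β ≡ x → col α γ ≡ y → col α γ' ≡ y →
                    col β γ ≡ col β γ' → γ ≡ γ'
      ∼⇒injective {x} {y} Xy x~y {β} {γ} {γ'} αβ αγ αγ' e with γ ≟ γ'
      ... | yes γ≡γ' = γ≡γ'
      ... | no  γ≢γ' = contradiction (≤-reflexive (trans Xy (sym x~y)))
              (<⇒≱ (≤-<-trans (count-surjection _ (F y ∖ γ') (col β) onto) (count-∖-< (F y) γ' (rel⁺ α γ' αγ'))))
        where
        onto : ∀ r → inProdᵇ col k α x y r ≡ true → ∃ λ δ → (F y ∖ γ') δ ≡ true × col β δ ≡ r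
        onto r h with product⁻ h β αβ
        ... | δ , αδ , βδ with γ' ≟ δ
        ...   | no γ'≢δ  = δ , ∧⁺ (rel⁺ α δ αδ) (not⌊⌋⁺ γ'≢δ) , βδ
        ...   | yes refl = γ , ∧⁺ (rel⁺ α γ αγ) (not⌊⌋⁺ (γ≢γ' ∘ sym)) , trans e βδ

      product≤k : ∀ {x y} → X x → X y → count (inProdᵇ col k α x y) ≤ k
      product≤k {x} {y} Xx Xy = let β , αβ = point Xx in
        subst (count (inProdᵇ col k α x y) ≤_) Xy
          (count-surjection _ (F y) (col β) λ r h →
             let γ , αγ , βγ = product⁻ h β αβ in γ , rel⁺ α γ αγ , βγ)

      injective⇒∼ : ∀ {x y} → X x → X y → ∀ β → col α β ≡ x →
                    (∀ γ γ' → col α γ ≡ y → col α γ' ≡ y → col β γ ≡ col β γ' → γ ≡ γ') → x ~ y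
      injective⇒∼ {x} {y} Xx Xy β refl inj = ≤-antisym (product≤k Xx Xy)
        (subst (_≤ count (inProdᵇ col k α x y)) Xy
          (count-injection (F y) _ (col β) into λ γ γ' e e' → inj γ γ' (rel⁻ α γ e) (rel⁻ α γ' e')))
        where
        into : ∀ γ → F y γ ≡ true → inProdᵇ col k α x y (col β γ) ≡ true
        into γ e = subst (λ y → inProdᵇ col k α x y (col β γ) ≡ true) (rel⁻ α γ e) (product⁺ β γ)

      ∼-sym : ∀ {x y} → X x → X y → x ~ y → y ~ x
      ∼-sym {x} {y} Xx Xy x~y = ≤-antisym (product≤k Xy Xx)
        (subst (_≤ count (inProdᵇ col k α y x)) x~y (count-injection _ _ (proj₁ ∘ converse) into inj))
        where
        into : ∀ r → inProdᵇ col k α x y r ≡ true → inProdᵇ col k α y x (proj₁ (converse r)) ≡ true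
        into r h with point Xx
        ... | β , refl with product⁻ h β refl
        ...   | γ , refl , refl = subst (λ s → inProdᵇ col k α y x s ≡ true)
                  (Equivalence.to (proj₂ (converse r) β γ) refl) (product⁺ γ β)
        inj : ∀ r r' → inProdᵇ col k α x y r ≡ true → inProdᵇ col k α x y r' ≡ true →
              proj₁ (converse r) ≡ proj₁ (converse r') → r ≡ r'
        inj r r' _ _ e = let β , γ , βγ = nonempty r in
          trans (sym βγ) (Equivalence.from (proj₂ (converse r') β γ)
            (trans (Equivalence.to (proj₂ (converse r) β γ) βγ) e))

      -- Two points of `α x` with the same colour to some `γ` in `α z` would make an intersection
      -- number at least 2. The same number can be read at a point `δ` of `α z` to which `β` has
      -- that colour, where the hypothesis on `β` allows only `β` itself.
      unconfused⇒∼ : ∀ {x z} → X x → X z → ∀ β → col α β ≡ x →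
                     (∀ γ β' → col α γ ≡ z → col α β' ≡ x → col β γ ≡ col β' γ → β ≡ β') → x ~ z
      unconfused⇒∼ {x} {z} Xx Xz β αβ unique = let γ , αγ = point Xz in
        ∼-sym Xz Xx (injective⇒∼ Xz Xx γ αγ (inj γ αγ))
        where
        inj : ∀ γ → col α γ ≡ z → ∀ β₁ β₂ → col α β₁ ≡ x → col α β₂ ≡ x → col γ β₁ ≡ col γ β₂ → β₁ ≡ β₂
        inj γ αγ β₁ β₂ αβ₁ αβ₂ e with β₁ ≟ β₂
        ... | yes β₁≡β₂ = β₁≡β₂
        ... | no  β₁≢β₂ =
          let δ , αδ , δβ = extend (trans αβ₁ (sym αβ)) γ
              r = col β₁ γ
              βδ = converse-colour δβ
              cnum≡ = coherent x r z α γ α δ αγ (trans αδ αγ)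
          in contradiction
               (2≤count (λ β' → rel col x α β' ∧ rel col r β' γ) β₁ β₂
                 (∧⁺ (rel⁺ α β₁ αβ₁) (rel⁺ β₁ γ refl))
                 (∧⁺ (rel⁺ α β₂ αβ₂) (rel⁺ β₂ γ (sym (converse-colour e))))
                 β₁≢β₂)
               (<⇒≱ (s≤s (subst (_≤ 1) (sym cnum≡)
                 (count≤1 _ λ β' β'' h h' → trans (sym (only δ αδ βδ β' h)) (only δ αδ βδ β'' h')))))
          where
          only : ∀ δ → col α δ ≡ col α γ → col β δ ≡ col β₁ γ →
                 ∀ β' → rel col x α β' ∧ rel col (col β₁ γ) β' δ ≡ true → β ≡ β'
          only δ αδ βδ β' h = unique δ β' (trans αδ αγ) (rel⁻ α β' (∧-conicalˡ _ _ h))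
            (trans βδ (sym (rel⁻ β' δ (∧-conicalʳ (rel col x α β') _ h))))

      -- Common neighbours of four indices

      module _ {c : ℕ} (agreement≤c : ∀ p q → p ≢ q → count (agreement p q) ≤ c)
               (6ck<X : 6 * c * (k ∸ 1) < ∣X∣ col k α) where

        common-neighbour : ∀ x₁ x₂ x₃ x₄ → X x₁ → X x₂ → X x₃ → X x₄ →
                           ∃ λ z → X z × x₁ ~ z × x₂ ~ z × x₃ ~ z × x₄ ~ z
        common-neighbour x₁ x₂ x₃ x₄ X₁ X₂ X₃ X₄ =
          z , Xz ,
          neighbour X₁ (λ γ → ≤-trans (m≤m+n _ _) (m≤m+n (D₁ γ + D₂ γ) (D₃ γ + D₄ γ))) ,
          neighbour X₂ (λ γ → ≤-trans (m≤n+m _ _) (m≤m+n (D₁ γ + D₂ γ) (D₃ γ + D₄ γ))) ,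
          neighbour X₃ (λ γ → ≤-trans (m≤m+n _ _) (m≤n+m (D₃ γ + D₄ γ) (D₁ γ + D₂ γ))) ,
          neighbour X₄ (λ γ → ≤-trans (m≤n+m _ _) (m≤n+m (D₃ γ + D₄ γ) (D₁ γ + D₂ γ)))
          where
          open ≤-Reasoning
          C : ∀ {x} → X x → Fin n → ℕ
          C {x} Xx = confusion (proj₁ (point Xx)) (F x)
          D₁ D₂ D₃ D₄ D : Fin n → ℕ
          D₁ = C X₁
          D₂ = C X₂
          D₃ = C X₃
          D₄ = C X₄
          D γ = (D₁ γ + D₂ γ) + (D₃ γ + D₄ γ)
          -- The factor is `k ∸ 1` because the chosen base point of the fiber is not compared with
          -- itself.
          sum-C : ∀ {x} (Xx : X x) → sum (C Xx) ≤ (k ∸ 1) * c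
          sum-C {x} Xx = let β , αβ = point Xx in ≤-trans (sum-confusion agreement≤c β (F x))
            (*-monoˡ-≤ c (<⇒≤pred (subst (count (F x ∖ β) <_) Xx (count-∖-< (F x) β (rel⁺ α β αβ)))))
          f : Fin m → ℕ
          f z = sum (λ γ → ⟦ F z γ ⟧ * D γ)
          -- The four fibers use `4 * c * (k ∸ 1)` of the available bound; the rest is slack.
          split : ∀ c d → 6 * c * d ≡ ((d * c + d * c) + (d * c + d * c)) + 2 * c * d
          split = solve-∀
          total : sum f < sum (λ z → ⟦ inXᵇ col k α z ⟧)
          total = begin-strict
            sum f                    ≤⟨ sum-over-fibers k α D ⟩
            sum D                    ≡⟨ ∑-distrib-+ (λ γ → D₁ γ + D₂ γ) (λ γ → D₃ γ + D₄ γ) ⟩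
            sum (λ γ → D₁ γ + D₂ γ) + sum (λ γ → D₃ γ + D₄ γ)
                                     ≡⟨ cong₂ _+_ (∑-distrib-+ D₁ D₂) (∑-distrib-+ D₃ D₄) ⟩
            (sum D₁ + sum D₂) + (sum D₃ + sum D₄)
                                     ≤⟨ +-mono-≤ (+-mono-≤ (sum-C X₁) (sum-C X₂)) (+-mono-≤ (sum-C X₃) (sum-C X₄)) ⟩
            (((k ∸ 1) * c + (k ∸ 1) * c) + ((k ∸ 1) * c + (k ∸ 1) * c))
                                     ≤⟨ m≤m+n _ _ ⟩
            (((k ∸ 1) * c + (k ∸ 1) * c) + ((k ∸ 1) * c + (k ∸ 1) * c)) + 2 * c * (k ∸ 1)
                                     ≡⟨ split c (k ∸ 1) ⟨
            6 * c * (k ∸ 1)          <⟨ 6ck<X ⟩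
            ∣X∣ col k α               ≡⟨ count≡sum (inXᵇ col k α) ⟩
            sum (λ z → ⟦ inXᵇ col k α z ⟧) ∎
          -- The right side is at most 1, so one strict inequality gives both facts at once: `z`
          -- lies in `X`, and no point of `α z` confuses any of the four base points.
          good : ∃ λ z → f z < ⟦ inXᵇ col k α z ⟧
          good = sum-<⇒∃< total
          z : Fin m
          z = proj₁ good
          fz<1 : f z < 1
          fz<1 = <-≤-trans (proj₂ good) (⟦⟧-mono {b = true} λ _ → refl)
          Xz : X z
          Xz = ⟦⟧>0 (proj₂ good)
            where
            ⟦⟧>0 : ∀ {A : Set} {d : Dec A} {i} → i < ⟦ ⌊ d ⌋ ⟧ → A
            ⟦⟧>0 {d = yes a} _ = a
          D<1 : ∀ γ → col α γ ≡ z → D γ < 1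
          D<1 γ αγ = ≤-<-trans (≤-reflexive (sym (trans (cong (λ b → ⟦ b ⟧ * D γ) (rel⁺ α γ αγ)) (*-identityˡ (D γ)))))
            (≤-<-trans (term≤sum (λ γ → ⟦ F z γ ⟧ * D γ) γ) fz<1)
          neighbour : ∀ {x} (Xx : X x) → (∀ γ → C Xx γ ≤ D γ) → x ~ z
          neighbour {x} Xx C≤D = let β , αβ = point Xx in
            unconfused⇒∼ Xx Xz β αβ λ γ β' αγ αβ' e →
              confusion-none β (F x) γ (≤-<-trans (C≤D γ) (D<1 γ αγ)) β' (rel⁺ α β' αβ') e

      -- Elements of M_α as cells of linked pairs

      diag-cell : ∀ β → cell k α β β ≐ diagOn (F (col α β))
      diag-cell β = ⊆-antisym
        (λ δ ε e → let f , g , _ = restr⁻ k α δ ε e in diagOn⁺ (F (col α β)) (rel⁺ α δ g) (diagonal-colour f))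
        from
        where
        from : diagOn (F (col α β)) ⊆ cell k α β β
        from δ ε e with diagOn⁻ (F (col α β)) e
        ... | h , refl = let g = rel⁻ α δ h in restr⁺ k α δ δ (colour-diagonal δ β) g g

      -- For a diagonal pair the source of the cell depends on `x ∼ x`: it belongs to S_α(x,x) if
      -- this holds, and otherwise it is the separately added diagonal.
      linked⇒M : ∀ {β γ ρ} → L β γ → ρ ≐ cell k α β γ → M ρ
      linked⇒M {β} {γ} (Xβ , Xγ , inj₁ adj) e = _ , _ , Xβ , Xγ , inj₁ (adj , _ , product⁺ β γ , e)
      linked⇒M {β} (Xβ , _ , inj₂ refl) e with count (inProdᵇ col k α (col α β) (col α β)) ≟ℕ k
      ... | yes adj = linked⇒M (Xβ , Xβ , inj₁ adj) e
      ... | no ≁  = _ , _ , Xβ , Xβ , inj₂ (≁ , refl , λ δ ε → trans (e δ ε) (diag-cell β δ ε))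

      M⇒linked : ∀ {ρ} → M ρ → ∃₂ λ β γ → L β γ × ρ ≐ cell k α β γ
      M⇒linked (x , y , Xx , Xy , inj₁ (adj , r , r∈ , e)) with point Xx
      ... | β , refl with product⁻ r∈ β refl
      ...   | γ , refl , refl = β , γ , (Xx , Xy , inj₁ adj) , e
      M⇒linked (x , .x , Xx , _ , inj₂ (_ , refl , e)) with point Xx
      ... | β , refl = β , β , (Xx , Xx , inj₂ refl) , λ δ ε → trans (e δ ε) (sym (diag-cell β δ ε))

      linked-transport : ∀ {β γ β' γ'} → L β γ → cell k α β γ β' γ' ≡ true → L β' γ'
      linked-transport {β' = β'} {γ'} (Xβ , Xγ , l) e with restr⁻ k α β' γ' e
      ... | f , g , h = subst X (sym g) Xβ , subst X (sym h) Xγ , move l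
        where
        move : _ → _
        move (inj₁ adj)  = inj₁ (subst₂ _~_ (sym g) (sym h) adj)
        move (inj₂ refl) = inj₂ (diagonal-colour f)

      -- Linkedness depends only on the colours, so any pair of an element of M_α can serve as its
      -- representative. Disjointness of the elements follows.
      ∈M⇒linked : ∀ {ρ β γ} → M ρ → ρ β γ ≡ true → L β γ × ρ ≐ cell k α β γ
      ∈M⇒linked {ρ} {β} {γ} Mρ ρβγ =
        let β₀ , γ₀ , l , e = M⇒linked Mρ
            h = ≐⁻ e β γ ρβγ
        in linked-transport l h , λ δ ε → trans (e δ ε) (cell-≐ k α h δ ε)

      linked-sym : ∀ {β γ} → L β γ → L γ β
      linked-sym (Xβ , Xγ , inj₁ adj) = Xγ , Xβ , inj₁ (∼-sym Xβ Xγ adj)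
      linked-sym (Xβ , Xγ , inj₂ e) = Xγ , Xβ , inj₂ (sym e)

      -- This is what makes every cell a matching: the first alternative is the injectivity given by
      -- `∼`, the second holds because the diagonal is a single colour.
      linked-unique : ∀ {β γ} → L β γ → ∀ γ' → col α γ' ≡ col α γ → col β γ' ≡ col β γ → γ ≡ γ'
      linked-unique (_ , Xγ , inj₁ adj)  γ' e f = ∼⇒injective Xγ adj refl refl e (sym f)
      linked-unique (_ , _ , inj₂ refl) γ' e f = diagonal-colour f

      linked-unique′ : ∀ {β γ} → L β γ → ∀ β' → col α β' ≡ col α β → col γ β' ≡ col γ β → β ≡ β'
      linked-unique′ l = linked-unique (linked-sym l)

      M-functional : ∀ {ρ} → M ρ → ∀ β γ γ' → ρ β γ ≡ true → ρ β γ' ≡ true → γ ≡ γ'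
      M-functional Mρ β γ γ' h h' =
        let l , e = ∈M⇒linked Mρ h
            f , _ , g = restr⁻ k α β γ' (≐⁻ e β γ' h')
        in linked-unique l γ' g f

      M-converse : ∀ {ρ} → M ρ → M (ρ ᵀ)
      M-converse Mρ =
        let β , γ , l , e = M⇒linked Mρ
        in linked⇒M (linked-sym l) λ δ ε → trans (e ε δ) (cellᵀ β γ δ ε)
        where
        cellᵀ : ∀ β γ → (cell k α β γ ᵀ) ≐ cell k α γ β
        cellᵀ β γ = ⊆-antisym (λ δ ε → flip β γ ε δ) (λ δ ε → flip γ β δ ε)
          where
          flip : ∀ β γ δ ε → cell k α β γ δ ε ≡ true → cell k α γ β ε δ ≡ true
          flip β γ δ ε h = let a , b , c = restr⁻ k α δ ε h in restr⁺ k α ε δ (converse-colour a) c b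

      M-matching : ∀ {ρ} → M ρ → IsMatching ρ
      M-matching Mρ = M-functional Mρ , λ β β' γ → M-functional (M-converse Mρ) γ β β'

      ∼⇒≈ : ∀ {x y} → X x → X y → x ~ y → _≈_ M X F x y
      ∼⇒≈ Xx Xy adj = (λ ρ Mρ → M-matching (proj₁ Mρ)) , cover Xx Xy adj
        where
        cover : ∀ {x y} → X x → X y → x ~ y → ∀ β γ → F x β ≡ true → F y γ ≡ true →
                Σ (Rel n) λ ρ → Mof M X F x y ρ × ρ β γ ≡ true
        cover {x} {y} Xx Xy adj β γ e f with rel⁻ α β e | rel⁻ α γ f
        ... | refl | refl = _ , (linked⇒M (Xx , Xy , inj₁ adj) (λ _ _ → refl) ,
                λ δ ε h → let _ , a , b = restr⁻ k α δ ε h in rel⁺ α δ a , rel⁺ α ε b) , cell-self k α β γ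

      -- When `x ∼ y` fails, a pair representing the given element can be linked only by equality,
      -- so the two fibers and their indices coincide.
      M-matching-or-diagonal : ∀ x y → X x → X y → (Σ (Rel n) λ ρ → Mof M X F x y ρ) →
        _≈_ M X F x y ⊎ (x ≡ y × (∀ ρ → Mof M X F x x ρ → ρ ≐ diagOn (F x)) × Mof M X F x x (diagOn (F x)))
      M-matching-or-diagonal x y Xx Xy (ρ , Mρ , ρ⊆) with count (inProdᵇ col k α x y) ≟ℕ k | M⇒linked Mρ
      ... | yes adj | _ = inj₁ (∼⇒≈ Xx Xy adj)
      ... | no ≁  | β , γ , (_ , _ , l) , e with ρ⊆ β γ (≐⁺ e β γ (cell-self k α β γ))
      ...   | f , g with rel⁻ α β f | rel⁻ α γ g
      ...     | refl | refl with l
      ...       | inj₁ adj  = contradiction adj ≁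
      ...       | inj₂ refl = inj₂ (refl , unique ≁ ,
                    linked⇒M (Xx , Xx , inj₂ refl) (λ δ ε → sym (diag-cell β δ ε)) , inside)
        where
        unique : ∀ {x} → ¬ (x ~ x) → ∀ ρ → Mof M X F x x ρ → ρ ≐ diagOn (F x)
        unique ≁ ρ (Mρ , ρ⊆) with M⇒linked Mρ
        ... | β , γ , (_ , _ , l) , e with ρ⊆ β γ (≐⁺ e β γ (cell-self k α β γ))
        ...   | f , g with rel⁻ α β f | rel⁻ α γ g | l
        ...     | βx | γx | inj₁ adj = contradiction (subst₂ _~_ βx γx adj) ≁
        ...     | refl | _  | inj₂ refl = λ δ ε → trans (e δ ε) (diag-cell β δ ε)
        inside : ∀ δ ε → diagOn (F x) δ ε ≡ true → F x δ ≡ true × F x ε ≡ true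
        inside δ ε h with diagOn⁻ (F x) h
        ... | e , refl = e , e

      M-fibers : ∀ Λ → IsFiber M Λ ⇔ (Σ (Fin m) λ x → X x × Λ ≐₁ F x)
      M-fibers Λ = mk⇔ to from
        where
        to : IsFiber M Λ → Σ (Fin m) λ x → X x × Λ ≐₁ F x
        to (ρ , Mρ , e) with M⇒linked Mρ
        ... | β , γ , (Xβ , _) , f with diagOn⁻ Λ (≐⁻ e β γ (≐⁺ f β γ (cell-self k α β γ)))
        ...   | _ , refl = col α β , Xβ , diagOn-injective
                  (λ δ ε → trans (sym (e δ ε)) (trans (f δ ε) (diag-cell β δ ε)))
        from : (Σ (Fin m) λ x → X x × Λ ≐₁ F x) → IsFiber M Λ
        from (x , Xx , e) with point Xx
        ... | β , refl = _ , linked⇒M (Xx , Xx , inj₂ refl) (λ _ _ → refl) ,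
                λ δ ε → trans (diag-cell β δ ε) (cong (_∧ ⌊ δ ≟ ε ⌋) (sym (e δ)))

      -- Coherence and products of matchings

      module _ {c : ℕ} (valency≤k : ∀ s β → valency col s β ≤ k)
               (agreement≤c : ∀ p q → p ≢ q → count (agreement p q) ≤ c)
               (large : 3 * (k * (k * c)) < n) where

        -- Linkedness of `βγ` and `γδ` supplies the two uniqueness conditions of `quadrangle`, with
        -- `γ` as the middle vertex.
        path-colour : ∀ {β γ δ β' γ' δ'} → L β γ → L γ δ →
                      cell k α β γ β' γ' ≡ true → cell k α γ δ γ' δ' ≡ true → col β' δ' ≡ col β δ
        path-colour {β' = β'} {γ'} {δ'} l l' h h' =
          let r , x , z = restr⁻ k α β' γ' h
              s , _ , y = restr⁻ k α γ' δ' h'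
          in quadrangle valency≤k agreement≤c large x z y r s (linked-unique′ l) (linked-unique l')

        -- Since `r` is functional, the intersection number is 0 or 1, so only positivity has to be
        -- carried from one pair to the other. Exchanging the pairs gives the reverse inequality.
        M-coherent : ∀ {r s t} → M r → M s → M t → ∀ {β γ β' γ'} → t β γ ≡ true → t β' γ' ≡ true →
                     cnum r s β γ ≤ cnum r s β' γ'
        M-coherent {r} {s} {t} Mr Ms Mt {β} {γ} {β'} {γ'} tβγ tβ'γ' with cnum r s β γ in eq
        ... | zero  = z≤n
        ... | suc j = subst (_≤ cnum r s β' γ') eq (≤-trans (count≤1 _ single) positive)
          where
          single : ∀ δ ε → r β δ ∧ s δ γ ≡ true → r β ε ∧ s ε γ ≡ true → δ ≡ ε
          single δ ε e f = M-functional Mr β δ ε (∧-conicalˡ _ _ e) (∧-conicalˡ _ _ f)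
          positive : 1 ≤ cnum r s β' γ'
          positive =
            -- The path `β`, `δ`, `γ` is copied step by step, starting at `β'`, to `β'`, `δ'`, `ε`.
            -- By `path-colour` its end has the colour from `β'` that `γ` has from `β`; as `t` is a
            -- matching, `ε` is `γ'`.
            let δ , e = count≥1⇒∃ (λ δ → r β δ ∧ s δ γ) (subst (1 ≤_) (sym eq) (s≤s z≤n))
                lr , r≐ = ∈M⇒linked Mr (∧-conicalˡ _ _ e)
                ls , s≐ = ∈M⇒linked Ms (∧-conicalʳ (r β δ) _ e)
                lt , t≐ = ∈M⇒linked Mt tβγ
                βγ , αβ , αγ = restr⁻ k α β' γ' (≐⁻ t≐ β' γ' tβ'γ')
                δ' , αδ , δβ = extend (sym αβ) δ
                ε , αε , εδ = extend (sym αδ) γ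
                h = restr⁺ k α β' δ' (converse-colour δβ) αβ αδ
                h' = restr⁺ k α δ' ε (converse-colour εδ) αδ αε
                lt' = linked-transport lt (restr⁺ k α β' γ' βγ αβ αγ)
                γ'≡ε = linked-unique lt' ε (trans αε (sym αγ)) (trans (path-colour lr ls h h') (sym βγ))
            in 1≤count _ δ' (∧⁺ (≐⁺ r≐ β' δ' h) (subst (λ t → s δ' t ≡ true) (sym γ'≡ε) (≐⁺ s≐ δ' ε h')))

        M-isPartialCC : IsPartialCC (Δα col k α) M
        M-isPartialCC = record
          { inside   = λ ρ Mρ β γ h → let (Xβ , Xγ , _) , _ = ∈M⇒linked Mρ h in Δα⁺ k α β Xβ , Δα⁺ k α γ Xγ
          ; nonempty = λ ρ Mρ → let β , γ , _ , e = M⇒linked Mρ in β , γ , ≐⁺ e β γ (cell-self k α β γ)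
          ; disjoint = λ ρ σ Mρ Mσ β γ h h' δ ε →
              trans (proj₂ (∈M⇒linked Mρ h) δ ε) (sym (proj₂ (∈M⇒linked Mσ h') δ ε))
          ; diagonal = (λ τ → ∃ λ β → β ∈X × τ ≐ cell k α β β)
                     , (λ { τ (β , Xβ , e) → linked⇒M (Xβ , Xβ , inj₂ refl) e })
                     , λ β γ → mk⇔ (to β γ) (from β γ)
          ; converse = λ ρ Mρ → _ , M-converse Mρ , λ _ _ → refl
          ; coherent = λ r s t Mr Ms Mt β γ β' γ' h h' →
              ≤-antisym (M-coherent Mr Ms Mt h h') (M-coherent Mr Ms Mt h' h)
          }
          where
          to : ∀ β γ → diagOn (Δα col k α) β γ ≡ true → Σ (Rel n) λ τ → (∃ λ δ → δ ∈X × τ ≐ cell k α δ δ) × τ β γ ≡ true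
          to β γ e with diagOn⁻ (Δα col k α) e
          ... | h , refl = _ , (β , Δα⁻ k α β h , λ _ _ → refl) , cell-self k α β β
          from : ∀ β γ → (Σ (Rel n) λ τ → (∃ λ δ → δ ∈X × τ ≐ cell k α δ δ) × τ β γ ≡ true) → diagOn (Δα col k α) β γ ≡ true
          from β γ (τ , (δ , Xδ , e) , h) =
            let f , g , _ = restr⁻ k α β γ (≐⁻ e β γ h)
            in diagOn⁺ (Δα col k α) (Δα⁺ k α β (subst X (sym g) Xδ)) (diagonal-colour f)

        -- The union is taken over all products contained in `ρ`. They cover `ρ`, because a path
        -- through any point of `α z` gives a product whose pairs all have the colour of its
        -- endpoints, by `path-colour`.
        Sα-union : ∀ x y z → X x → X y → X z → x ~ z → z ~ y → ∀ ρ → Sα col k α x y ρ →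
                   IsUnionOf (Mα⟨_,_⟩ col k α x z ·ˢ Mα⟨_,_⟩ col k α z y) ρ
        Sα-union x y z Xx Xy Xz x~z z~y ρ (t , t∈ , ρ≐) =
          (λ τ → R τ × τ ⊆ ρ) , (λ τ → proj₁) , λ β γ → mk⇔ (to β γ) (λ { (τ , (_ , τ⊆ρ) , h) → τ⊆ρ β γ h })
          where
          R : RelSet
          R = Mα⟨_,_⟩ col k α x z ·ˢ Mα⟨_,_⟩ col k α z y
          γ : Fin n
          γ = proj₁ (point Xz)
          αγ : col α γ ≡ z
          αγ = proj₂ (point Xz)
          to : ∀ β δ → ρ β δ ≡ true → Σ (Rel n) λ τ → (R τ × τ ⊆ ρ) × τ β δ ≡ true
          to β δ h with restr⁻ k α β δ (≐⁻ ρ≐ β δ h)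
          ... | refl , refl , refl with γ | αγ
          ...   | γ | refl = r ⨾ s , ((r , s , r∈ , s∈ , λ _ _ → refl) , ⊆ρ) , ⨾⁺ r s (cell-self k α β γ) (cell-self k α γ δ)
            where
            r s : Rel n
            r = cell k α β γ
            s = cell k α γ δ
            r∈ : Mα⟨_,_⟩ col k α (col α β) (col α γ) r
            r∈ = inj₁ (x~z , _ , product⁺ β γ , λ _ _ → refl)
            s∈ : Mα⟨_,_⟩ col k α (col α γ) (col α δ) s
            s∈ = inj₁ (z~y , _ , product⁺ γ δ , λ _ _ → refl)
            ⊆ρ : (r ⨾ s) ⊆ ρ
            ⊆ρ β' δ' e =
              let γ' , f , g = ⨾⁻ r s e
                  _ , αβ , _ = restr⁻ k α β' γ' f
                  _ , _ , αδ = restr⁻ k α γ' δ' g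
              in ≐⁺ ρ≐ β' δ' (restr⁺ k α β' δ'
                   (path-colour {β} {γ} {δ} (Xx , Xz , inj₁ x~z) (Xz , Xy , inj₁ z~y) f g) αβ αδ)

theorem5p1 : ∀ {n m : ℕ} (col : Fin n → Fin n → Fin m) →
    IsHomogeneousCC col →
    (k c : ℕ) → IsMaxValency col k → 1 < k → IsIndistinguishingNumber col c →
    (α : Fin n) → 6 * c * (k ∸ 1) < ∣X∣ col k α →
    IsSaturatedMatchingConfig (Δα col k α) (Mα col k α) (inX col k α) (fiber col k α)
    × (∀ x y z → inX col k α x → inX col k α y → inX col k α z →
    _∼_ col k α x z → _∼_ col k α z y →
    ∀ ρ → Sα col k α x y ρ →
    IsUnionOf (Mα⟨_,_⟩ col k α x z ·ˢ Mα⟨_,_⟩ col k α z y) ρ)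
theorem5p1 {n} col hom k c (valency≤k , _) 1<k (indist≤c , _) α 6ck<X =
  record
    { partialCC = M-isPartialCC col hom 1<k α valency≤k agreement≤c large
    ; fibers    = M-fibers col hom 1<k α
    ; indexing  = λ x y Xx Xy e → let β , αβ = point col hom 1<k α Xx in
                    trans (sym αβ) (rel⁻ col α β (trans (sym (e β)) (rel⁺ col α β αβ)))
    ; matching  = M-matching-or-diagonal col hom 1<k α
    ; saturated = λ x₁ x₂ x₃ x₄ X₁ X₂ X₃ X₄ →
        let z , Xz , ∼₁ , ∼₂ , ∼₃ , ∼₄ = common-neighbour col hom 1<k α agreement≤c 6ck<X x₁ x₂ x₃ x₄ X₁ X₂ X₃ X₄
            ≈z = λ {x} (Xx : inX col k α x) → ∼⇒≈ col hom 1<k α Xx Xz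
        in z , Xz , ≈z X₁ ∼₁ , ≈z X₂ ∼₂ , ≈z X₃ ∼₃ , ≈z X₄ ∼₄
    }
  , Sα-union col hom 1<k α valency≤k agreement≤c large
  where
  agreement≤c : ∀ p q → p ≢ q → count (agreement col p q) ≤ c
  agreement≤c p q p≢q = ≤-trans (agreement≤indistSum col p q)
    -- The bound `c` applies because a diagonal colour would make `p` and `q` equal.
    (indist≤c (col p q) (λ diag → p≢q (Equivalence.to (diag p q) refl)) p q refl)
  large : 3 * (k * (k * c)) < n
  large = bound k 1<k 6ck<X (X*k≤n col k α)
    where
    bound : ∀ k {N} → 1 < k → 6 * c * (k ∸ 1) < N → N * k ≤ n → 3 * (k * (k * c)) < n
    bound (suc zero)    (s≤s ()) _ _
    -- With `k = 2 + j`, the inequality `k ≤ 2 * (k ∸ 1)` turns `3 * k * k * c` into at most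
    -- `6 * c * (k ∸ 1) * k`; the exact difference is `3 * j * c * k`.
    bound (suc (suc j)) {N} _ lt Nk≤n = begin-strict
      3 * ((2 + j) * ((2 + j) * c))                            ≤⟨ m≤m+n _ _ ⟩
      3 * ((2 + j) * ((2 + j) * c)) + 3 * j * c * (2 + j)      ≡⟨ rearrange j c ⟩
      6 * c * suc j * (2 + j)                                  <⟨ *-monoˡ-< (2 + j) lt ⟩
      N * (2 + j)                                              ≤⟨ Nk≤n ⟩
      n                                                        ∎
      where
      open ≤-Reasoning
      rearrange : ∀ j c → 3 * ((2 + j) * ((2 + j) * c)) + 3 * j * c * (2 + j) ≡ 6 * c * suc j * (2 + j)
      rearrange = solve-∀
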